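{- Consider COMPLEMENT-GRUNDY. Then $\mathcal{SG}(n)/n\rightarrow 0$, as $n\rightarrow \infty$.
   Context: COMPLEMENT-GRUNDY is the impartial normal-play heap game where a move replaces a heap $n$ by the disjunctive sum of $k$ heaps of size $d$ and one heap of size $r$ (omitted if $r=0$), where $n=kd+r$, $1\le d<n$, $0\le r<d$, and $k\ge 2$; a heap of size $1$ is terminal. $\mathcal{SG}$ denotes the Sprague-Grundy value (mex rule, nim-sum for disjunctive sums). -}

module Defs where

open import Data.Nat using (ℕ; zero; suc; _+_; _*_; _∸_; _≤_; _<_; _≥_; _⊔_; z≤n; s≤s; s≤s⁻¹; NonZero; _/_; _%_; _≤?_)
open import Data.Nat.Properties
open import Data.Nat.DivMod
open import Data.Nat.Divisibility using (divides-refl)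
open import Data.Rational using (ℚ; 0ℚ; ∣_∣; _-_) renaming (_<_ to _<ℚ_)
open import Data.List using (List; []; _∷_; _++_; [_]; map; foldr; filter; replicate; upTo)
open import Data.List.Properties using (map-cong-local)
open import Data.List.Extrema.Nat using (max; xs≤max)
open import Data.List.Membership.Propositional using (_∈_; _∉_)
open import Data.List.Membership.Propositional.Properties using (∈-map⁺; ∈-map⁻; ∈-filter⁺; ∈-filter⁻; ∈-upTo⁺; ∈-upTo⁻)
open import Data.List.Membership.DecPropositional _≟_ using (_∈?_)
open import Data.List.Relation.Unary.All using (All; []; _∷_; lookup)
import Data.List.Relation.Unary.All as All
import Data.List.Relation.Unary.All.Properties as All
open import Data.Product using (_×_; _,_; ∃-syntax; proj₁; proj₂)
open import Data.Sum using (inj₁; inj₂)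
open import Relation.Nullary using (¬_; yes; no)
open import Relation.Binary.PropositionalEquality using (_≡_; refl; sym; trans; cong; cong₂; subst)

-- A position is a disjunctive sum of heaps, listed by size.
Position : Set
Position = List ℕ

remainderHeap : ℕ → Position
remainderHeap zero    = []
remainderHeap (suc r) = [ suc r ]

heaps : (k d r : ℕ) → Position
heaps k d r = replicate k d ++ remainderHeap r

infix 4 _⟶_

data _⟶_ (n : ℕ) : Position → Set where
  move : ∀ {k d r} → n ≡ k * d + r → 1 ≤ d → d < n → r < d → 2 ≤ k →
         n ⟶ heaps k d r

-- The index i stands for d = suc i; then k = n / d and r = n % d are forced.
options : ℕ → List Position
options n =
  map (λ i → heaps (n / suc i) (suc i) (n % suc i))
      (filter (λ i → 2 ≤? n / suc i) (upTo (n ∸ 1)))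

mexFrom : (fuel k : ℕ) → List ℕ → ℕ
mexFrom zero       k xs = k
mexFrom (suc fuel) k xs with k ∈? xs
... | yes _ = mexFrom fuel (suc k) xs
... | no  _ = k

-- The fuel suffices because suc (max 0 xs) ∉ xs; see mex-isMex.
mex : List ℕ → ℕ
mex xs = mexFrom (suc (max 0 xs)) 0 xs

nimSumFuel : (fuel m n : ℕ) → ℕ
nimSumFuel zero       m n = 0
nimSumFuel (suc fuel) m n = (m + n) % 2 + 2 * nimSumFuel fuel (m / 2) (n / 2)

-- Bitwise exclusive or; the fuel suffices by ⊕-unfold.
infixl 6 _⊕_
_⊕_ : ℕ → ℕ → ℕ
m ⊕ n = nimSumFuel (m ⊔ n) m n

nimSum : List ℕ → ℕ
nimSum = foldr _⊕_ 0

SGFuel : (fuel n : ℕ) → ℕ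
SGFuel zero       n = 0
SGFuel (suc fuel) n = mex (map (λ p → nimSum (map (SGFuel fuel) p)) (options n))

-- Moves produce only smaller heaps, so fuel n suffices for a heap n; see SG-unfold.
SG : ℕ → ℕ
SG n = SGFuel n n

-- Convergence of a sequence of rationals indexed by the positive integers.
-- Rational ε are cofinal among positive reals, so nothing is lost.
_ConvergesTo_ : ((n : ℕ) → .{{NonZero n}} → ℚ) → ℚ → Set
f ConvergesTo l =
  ∀ (ε : ℚ) → 0ℚ <ℚ ε →
  ∃[ N ] (∀ (n : ℕ) .{{_ : NonZero n}} → n ≥ N → ∣ f n - l ∣ <ℚ ε)

IsMex : (ℕ → Set) → ℕ → Set
IsMex S m = ¬ S m × (∀ {j} → j < m → S j)

mexFrom-below : ∀ fuel k xs → (∀ {j} → j < k → j ∈ xs) →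
                ∀ {j} → j < mexFrom fuel k xs → j ∈ xs
mexFrom-below zero       k xs h = h
mexFrom-below (suc fuel) k xs h with k ∈? xs
... | no  _ = h
... | yes k∈xs = mexFrom-below fuel (suc k) xs h′
  where
  h′ : ∀ {j} → j < suc k → j ∈ xs
  h′ j<1+k with m≤n⇒m<n∨m≡n (s≤s⁻¹ j<1+k)
  ... | inj₁ j<k  = h j<k
  ... | inj₂ refl = k∈xs

mexFrom-∉ : ∀ fuel k xs → max 0 xs < fuel + k → mexFrom fuel k xs ∉ xs
mexFrom-∉ zero       k xs lt k∈xs = <⇒≱ lt (lookup (xs≤max 0 xs) k∈xs)
mexFrom-∉ (suc fuel) k xs lt with k ∈? xs
... | no  k∉xs = k∉xs
... | yes _    = mexFrom-∉ fuel (suc k) xs (subst (max 0 xs <_) (sym (+-suc fuel k)) lt)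

mex-isMex : ∀ xs → IsMex (_∈ xs) (mex xs)
mex-isMex xs =
  mexFrom-∉ _ 0 xs (≤-reflexive (sym (+-identityʳ _))) ,
  mexFrom-below _ 0 xs λ ()

nimSumFuel-zero : ∀ fuel → nimSumFuel fuel 0 0 ≡ 0
nimSumFuel-zero zero       = refl
nimSumFuel-zero (suc fuel) = cong (2 *_) (nimSumFuel-zero fuel)

half≤ : ∀ {m f} → m ≤ suc f → m / 2 ≤ f
half≤ {zero}  _  = z≤n
half≤ {suc m} le = s≤s⁻¹ (≤-trans (m/n<m (suc m) 2 (s≤s (s≤s z≤n))) le)

nimSumFuel-irr : ∀ f g {m n} → m ≤ f → n ≤ f → m ≤ g → n ≤ g →
                 nimSumFuel f m n ≡ nimSumFuel g m n
nimSumFuel-irr zero    g       z≤n z≤n _   _   = sym (nimSumFuel-zero g)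
nimSumFuel-irr (suc f) zero    _   _   z≤n z≤n = nimSumFuel-zero (suc f)
nimSumFuel-irr (suc f) (suc g) {m} {n} a b c d =
  cong (λ x → (m + n) % 2 + 2 * x)
       (nimSumFuel-irr f g (half≤ a) (half≤ b) (half≤ c) (half≤ d))

⊕-unfold : ∀ m n → m ⊕ n ≡ (m + n) % 2 + 2 * ((m / 2) ⊕ (n / 2))
⊕-unfold m n = trans
  (nimSumFuel-irr (m ⊔ n) (suc (m ⊔ n)) m≤ n≤ (m≤n⇒m≤1+n m≤) (m≤n⇒m≤1+n n≤))
  (cong (λ x → (m + n) % 2 + 2 * x)
    (nimSumFuel-irr (m ⊔ n) (m / 2 ⊔ n / 2)
      (≤-trans (m/n≤m m 2) m≤) (≤-trans (m/n≤m n 2) n≤)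
      (m≤m⊔n (m / 2) (n / 2)) (m≤n⊔m (m / 2) (n / 2))))
  where
  m≤ = m≤m⊔n m n
  n≤ = m≤n⊔m m n

options-sound : ∀ {n p} → p ∈ options n → n ⟶ p
options-sound {n} p∈ with ∈-map⁻ _ p∈
... | i , i∈ , refl with ∈-filter⁻ (λ i → 2 ≤? n / suc i) i∈
... | i∈upTo , 2≤k =
  move (trans (m≡m%n+[m/n]*n n (suc i)) (+-comm (n % suc i) _))
       (s≤s z≤n) (bound n (∈-upTo⁻ i∈upTo)) (m%n<n n (suc i)) 2≤k
  where
  bound : ∀ n → i < n ∸ 1 → suc i < n
  bound (suc n) lt = s≤s lt

options-complete : ∀ {n p} → n ⟶ p → p ∈ options n
options-complete (move {k} {suc i} {r} refl 1≤d d<n r<d 2≤k) =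
  subst (_∈ options n) (cong₂ (λ k r → heaps k (suc i) r) k-eq r-eq)
    (∈-map⁺ _ (∈-filter⁺ (λ i → 2 ≤? n / suc i) (∈-upTo⁺ (∸-monoˡ-≤ 1 d<n))
                (subst (2 ≤_) (sym k-eq) 2≤k)))
  where
  n = k * suc i + r
  k-eq : n / suc i ≡ k
  k-eq = trans (+-distrib-/-∣ˡ r (divides-refl k))
    (trans (cong₂ _+_ (m*n/n≡m k (suc i)) (m<n⇒m/n≡0 r<d)) (+-identityʳ k))
  r-eq : n % suc i ≡ r
  r-eq = trans (cong (_% suc i) (+-comm (k * suc i) r))
    (trans ([m+kn]%n≡m%n r k (suc i)) (m<n⇒m%n≡m r<d))

⟶-smaller : ∀ {n p} → n ⟶ p → All (_< n) p
⟶-smaller (move {k} {d} {r} _ _ d<n r<d _) = All.++⁺ (All.replicate⁺ k d<n) (rem r r<d)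
  where
  rem : ∀ r → r < d → All (_< _) (remainderHeap r)
  rem zero    _   = []
  rem (suc r) r<d = <-trans r<d d<n ∷ []

SGFuel-irr : ∀ f g {n} → n ≤ f → n ≤ g → SGFuel f n ≡ SGFuel g n
SGFuel-irr zero    zero    _   _   = refl
SGFuel-irr zero    (suc g) z≤n _   = refl
SGFuel-irr (suc f) zero    _   z≤n = refl
SGFuel-irr (suc f) (suc g) {n} a b = cong mex (map-cong-local
  (All.tabulate λ p∈ → cong nimSum (map-cong-local
    (All.map (λ h<n → SGFuel-irr f g (s≤s⁻¹ (≤-trans h<n a)) (s≤s⁻¹ (≤-trans h<n b)))
             (⟶-smaller (options-sound {n} p∈))))))

SG-unfold : ∀ n → SG n ≡ mex (map (λ p → nimSum (map SG p)) (options n))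
SG-unfold n = trans (SGFuel-irr n (suc n) ≤-refl (n≤1+n n)) (cong mex (map-cong-local
  (All.tabulate λ p∈ → cong nimSum (map-cong-local
    (All.map (λ {h} h<n → SGFuel-irr n h (<⇒≤ h<n) ≤-refl)
             (⟶-smaller (options-sound {n} p∈)))))))

SG-isMex : ∀ n → IsMex (λ v → ∃[ p ] n ⟶ p × v ≡ nimSum (map SG p)) (SG n)
SG-isMex n rewrite SG-unfold n =
  (λ { (p , n⟶p , eq) → proj₁ (mex-isMex xs)
         (subst (_∈ xs) (sym eq) (∈-map⁺ _ (options-complete n⟶p))) }) ,
  (λ j<m → let p , p∈ , eq = ∈-map⁻ _ (proj₂ (mex-isMex xs) j<m)
           in p , options-sound p∈ , eq)
  where
  xs = map (λ p → nimSum (map SG p)) (options n)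

{-# OPTIONS --safe #-}

-- Since equal heaps cancel in pairs, an option kd + r of n has value SG r or
-- SG d ⊕ SG r, the latter only for k ≥ 3, where d + r ≤ n / 2.  As x ⊕ y ≤ x + y,
-- a bound SG m ≤ m / K + O(1) for all m improves to SG n ≤ n / 2K + O(1).
module Submission where

open import Defs
open import Data.Integer using (+_)
import Data.Integer as ℤ
import Data.Integer.Properties as ℤₚ
open import Data.List using (map)
open import Data.Nat using (zero; suc; _+_; _*_; _≤_; _<_; z≤n; s≤s; z<s; _%_)
import Data.Nat as ℕ
open import Data.Nat.DivMod using (m%n<n; m%n≤m; m≡m%n+[m/n]*n; m<n⇒m%n≡m; m<n⇒m/n≡0; m*n/n≡m; [m+kn]%n≡m%n; +-distrib-/-∣ʳ; %-distribˡ-+)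
open import Data.Nat.Divisibility using (divides-refl)
open import Data.Nat.Induction using (<-rec)
open import Data.Nat.Properties
open import Data.Nat.Tactic.RingSolver using (solve-∀)
open import Data.Product using (_×_; _,_; ∃-syntax; proj₂)
open import Data.Rational using (0ℚ; _/_; mkℚ; ∣_∣; _-_; *<*; fromℚᵘ; toℚᵘ) renaming (_<_ to _<ℚ_; _≤_ to _≤ℚ_)
import Data.Rational.Properties as ℚₚ
open import Data.Rational.Unnormalised using (mkℚᵘ)
import Data.Rational.Unnormalised as ℚᵘ
import Data.Rational.Unnormalised.Properties as ℚᵘₚ
open import Relation.Binary.PropositionalEquality using (_≡_; refl; sym; trans; cong; cong₂; subst; module ≡-Reasoning)

n≡n%2+2*[n/2] : ∀ n → n ≡ n % 2 + 2 * (n ℕ./ 2)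
n≡n%2+2*[n/2] n = trans (m≡m%n+[m/n]*n n 2) (cong (λ x → n % 2 + x) (*-comm (n ℕ./ 2) 2))

[b+2q]%2≡b : ∀ {b} q → b < 2 → (b + 2 * q) % 2 ≡ b
[b+2q]%2≡b {b} q b<2 = begin
  (b + 2 * q) % 2  ≡⟨ cong (λ x → (b + x) % 2) (*-comm 2 q) ⟩
  (b + q * 2) % 2  ≡⟨ [m+kn]%n≡m%n b q 2 ⟩
  b % 2            ≡⟨ m<n⇒m%n≡m b<2 ⟩
  b                ∎
  where open ≡-Reasoning

[b+2q]/2≡q : ∀ {b} q → b < 2 → (b + 2 * q) ℕ./ 2 ≡ q
[b+2q]/2≡q {b} q b<2 = begin
  (b + 2 * q) ℕ./ 2            ≡⟨ cong (λ x → (b + x) ℕ./ 2) (*-comm 2 q) ⟩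
  (b + q * 2) ℕ./ 2            ≡⟨ +-distrib-/-∣ʳ b (divides-refl q) ⟩
  b ℕ./ 2 + (q * 2) ℕ./ 2      ≡⟨ cong₂ _+_ (m<n⇒m/n≡0 b<2) (m*n/n≡m q 2) ⟩
  q                            ∎
  where open ≡-Reasoning

⊕-%2 : ∀ m n → (m ⊕ n) % 2 ≡ (m + n) % 2
⊕-%2 m n = trans (cong (_% 2) (⊕-unfold m n)) ([b+2q]%2≡b (m ℕ./ 2 ⊕ n ℕ./ 2) (m%n<n (m + n) 2))

⊕-/2 : ∀ m n → (m ⊕ n) ℕ./ 2 ≡ m ℕ./ 2 ⊕ n ℕ./ 2
⊕-/2 m n = trans (cong (ℕ._/ 2) (⊕-unfold m n)) ([b+2q]/2≡q (m ℕ./ 2 ⊕ n ℕ./ 2) (m%n<n (m + n) 2))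

[m+[m⊕n]]%2≡n%2 : ∀ m n → (m + (m ⊕ n)) % 2 ≡ n % 2
[m+[m⊕n]]%2≡n%2 m n = begin
  (m + (m ⊕ n)) % 2              ≡⟨ %-distribˡ-+ m (m ⊕ n) 2 ⟩
  (m % 2 + (m ⊕ n) % 2) % 2      ≡⟨ cong (λ x → (m % 2 + x) % 2) (⊕-%2 m n) ⟩
  (m % 2 + (m + n) % 2) % 2      ≡⟨ %-distribˡ-+ m (m + n) 2 ⟨
  (m + (m + n)) % 2              ≡⟨ cong (_% 2) (m+[m+n]≡n+m*2 m n) ⟩
  (n + m * 2) % 2                ≡⟨ [m+kn]%n≡m%n n m 2 ⟩
  n % 2                          ∎
  where
  open ≡-Reasoning
  m+[m+n]≡n+m*2 : ∀ m n → m + (m + n) ≡ n + m * 2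
  m+[m+n]≡n+m*2 = solve-∀

-- The lowest bits agree by `[m+[m⊕n]]%2≡n%2`, the remaining bits by induction on the halves. The
-- common bound `b` makes this recursion structural.
⊕-cancel-bounded : ∀ b {m n} → m ≤ b → n ≤ b → m ⊕ (m ⊕ n) ≡ n
⊕-cancel-bounded zero z≤n z≤n = refl
⊕-cancel-bounded (suc b) {m} {n} m≤ n≤ = begin
  m ⊕ (m ⊕ n)                                                ≡⟨ ⊕-unfold m (m ⊕ n) ⟩
  (m + (m ⊕ n)) % 2 + 2 * (m ℕ./ 2 ⊕ (m ⊕ n) ℕ./ 2)          ≡⟨ cong₂ (λ x y → x + 2 * (m ℕ./ 2 ⊕ y)) ([m+[m⊕n]]%2≡n%2 m n) (⊕-/2 m n) ⟩
  n % 2 + 2 * (m ℕ./ 2 ⊕ (m ℕ./ 2 ⊕ n ℕ./ 2))                ≡⟨ cong (λ x → n % 2 + 2 * x) (⊕-cancel-bounded b (half≤ m≤) (half≤ n≤)) ⟩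
  n % 2 + 2 * (n ℕ./ 2)                                      ≡⟨ n≡n%2+2*[n/2] n ⟨
  n                                                          ∎
  where open ≡-Reasoning

⊕-cancel : ∀ m n → m ⊕ (m ⊕ n) ≡ n
⊕-cancel m n = ⊕-cancel-bounded (m + n) (m≤m+n m n) (m≤n+m n m)

-- Nim-sum is addition without carries, so every bit is at most the sum of the two bits above it.
-- Any fuel will do, since running out yields 0.
nimSumFuel≤+ : ∀ f m n → nimSumFuel f m n ≤ m + n
nimSumFuel≤+ zero    m n = z≤n
nimSumFuel≤+ (suc f) m n = begin
  (m + n) % 2 + 2 * nimSumFuel f (m ℕ./ 2) (n ℕ./ 2)        ≤⟨ +-mono-≤ parity (*-monoʳ-≤ 2 (nimSumFuel≤+ f (m ℕ./ 2) (n ℕ./ 2))) ⟩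
  (m % 2 + n % 2) + 2 * (m ℕ./ 2 + n ℕ./ 2)                 ≡⟨ regroup (m % 2) (n % 2) (m ℕ./ 2) (n ℕ./ 2) ⟩
  (m % 2 + 2 * (m ℕ./ 2)) + (n % 2 + 2 * (n ℕ./ 2))         ≡⟨ cong₂ _+_ (n≡n%2+2*[n/2] m) (n≡n%2+2*[n/2] n) ⟨
  m + n                                                     ∎
  where
  open ≤-Reasoning
  parity : (m + n) % 2 ≤ m % 2 + n % 2
  parity = ≤-trans (≤-reflexive (%-distribˡ-+ m n 2)) (m%n≤m (m % 2 + n % 2) 2)
  regroup : ∀ a b c d → (a + b) + 2 * (c + d) ≡ (a + 2 * c) + (b + 2 * d)
  regroup = solve-∀

⊕≤+ : ∀ m n → m ⊕ n ≤ m + n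
⊕≤+ m n = nimSumFuel≤+ (m ℕ.⊔ n) m n

remainderHeap-value : ∀ r → nimSum (map SG (remainderHeap r)) ≤ SG r
remainderHeap-value zero    = z≤n
remainderHeap-value (suc r) = ≤-trans (⊕≤+ (SG (suc r)) 0) (≤-reflexive (+-identityʳ _))

-- The list on the left unfolds to `d ∷ d ∷ heaps k d r`, whose first two entries cancel.
heaps-value : ∀ k d r → nimSum (map SG (heaps (2 + k) d r)) ≡ nimSum (map SG (heaps k d r))
heaps-value k d r = ⊕-cancel (SG d) (nimSum (map SG (heaps k d r)))

-- For even k the value is at most SG r, which is covered by a = 0, as SG 0 = 0.
heaps-value-≤ : ∀ k d r → r < d → 2 ≤ k →
  ∃[ a ] ∃[ b ] (2 * (a + b) ≤ k * d + r × nimSum (map SG (heaps k d r)) ≤ SG a + SG b)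
heaps-value-≤ 1 d r r<d (s≤s ())
heaps-value-≤ 2 d r r<d _ =
  0 , r , size , subst (_≤ SG r) (sym (heaps-value 0 d r)) (remainderHeap-value r)
  where
  size : 2 * r ≤ 2 * d + r
  size = ≤-trans (*-monoʳ-≤ 2 (<⇒≤ r<d)) (m≤m+n (2 * d) r)
-- One heap `d` survives the cancellation. Trading one `r` for the larger `d` turns `2 * (d + r)`
-- into `3 * d + r`.
heaps-value-≤ 3 d r r<d _ = d , r , size , (begin
  nimSum (map SG (heaps 3 d r))                ≡⟨ heaps-value 1 d r ⟩
  SG d ⊕ nimSum (map SG (remainderHeap r))     ≤⟨ ⊕≤+ (SG d) _ ⟩
  SG d + nimSum (map SG (remainderHeap r))     ≤⟨ +-monoʳ-≤ (SG d) (remainderHeap-value r) ⟩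
  SG d + SG r                                  ∎)
  where
  open ≤-Reasoning
  regroup₁ : ∀ d r → 2 * (d + r) ≡ 2 * d + r + r
  regroup₁ = solve-∀
  regroup₂ : ∀ d r → 2 * d + r + d ≡ 3 * d + r
  regroup₂ = solve-∀
  size : 2 * (d + r) ≤ 3 * d + r
  size = begin
    2 * (d + r)     ≡⟨ regroup₁ d r ⟩
    2 * d + r + r   ≤⟨ +-monoʳ-≤ (2 * d + r) (<⇒≤ r<d) ⟩
    2 * d + r + d   ≡⟨ regroup₂ d r ⟩
    3 * d + r       ∎
-- For four or more heaps, dropping a pair keeps the value and shrinks the total, so the same `a`
-- and `b` serve. The pattern keeps `k` at least 2, so the descent ends at 2 or 3.
heaps-value-≤ (suc (suc k@(suc (suc _)))) d r r<d _ =
  let a , b , size , value = heaps-value-≤ k d r r<d (s≤s (s≤s z≤n))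
  in a , b
   , ≤-trans size (+-monoˡ-≤ r (*-monoˡ-≤ d (m≤n+m k 2)))
   , subst (_≤ SG a + SG b) (sym (heaps-value k d r)) value

-- By the mex rule `v` is the value of some option. The fact `0 < n` is recorded so that
-- `2 * (a + b) ≤ n` yields `a + b < n`.
below-SG : ∀ {n v} → v < SG n → 0 < n × ∃[ a ] ∃[ b ] (2 * (a + b) ≤ n × v ≤ SG a + SG b)
below-SG {n} v<SG with proj₂ (SG-isMex n) v<SG
... | _ , move {k} {d} {r} refl _ d<n r<d 2≤k , refl =
  ≤-<-trans z≤n d<n , heaps-value-≤ k d r r<d 2≤k

2m≤n⇒m<n : ∀ {m n} → 0 < n → 2 * m ≤ n → m < n
2m≤n⇒m<n {zero}  0<n _    = 0<n
2m≤n⇒m<n {suc m} _   2m≤n = <-≤-trans (m<m+n (suc m) z<s) 2m≤n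

-- Starting point for the doubling. By strong induction, every `v < SG n` satisfies
-- `v ≤ SG a + SG b ≤ a + b < n`.
SG≤n : ∀ n → SG n ≤ n
SG≤n = <-rec _ λ n rec → all-below-≤ (λ v<SG →
  let 0<n , a , b , size , v≤ = below-SG {n} v<SG
      a+b<n = 2m≤n⇒m<n 0<n size
  in ≤-<-trans (≤-trans v≤ (+-mono-≤ (rec (≤-<-trans (m≤m+n a b) a+b<n))
                                     (rec (≤-<-trans (m≤n+m b a) a+b<n)))) a+b<n)
  where
  all-below-≤ : ∀ {m n} → (∀ {v} → v < m → v < n) → m ≤ n
  all-below-≤ {zero}  _ = z≤n
  all-below-≤ {suc m} h = h ≤-refl

-- `below-SG` is applied to the predecessor of `SG n`; restoring the lost 1 costs `2 * K`. Using the
-- bound for `a` and for `b`, doubled, costs `4 * C`.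
SG-bound-double : ∀ K C → (∀ m → K * SG m ≤ m + C) → ∀ n → 2 * K * SG n ≤ n + (4 * C + 2 * K)
SG-bound-double K C bound n with SG n in eq
... | zero  = ≤-trans (≤-reflexive (*-zeroʳ (2 * K))) z≤n
... | suc v with below-SG {n} (≤-reflexive (sym eq))
... | _ , a , b , size , v≤ = begin
  2 * K * suc v                              ≤⟨ *-monoʳ-≤ (2 * K) (s≤s v≤) ⟩
  2 * K * suc (SG a + SG b)                  ≡⟨ expand K (SG a) (SG b) ⟩
  2 * (K * SG a + K * SG b) + 2 * K          ≤⟨ +-monoˡ-≤ (2 * K) (*-monoʳ-≤ 2 (+-mono-≤ (bound a) (bound b))) ⟩
  2 * ((a + C) + (b + C)) + 2 * K            ≡⟨ regroup a b C K ⟩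
  2 * (a + b) + (4 * C + 2 * K)              ≤⟨ +-monoˡ-≤ (4 * C + 2 * K) size ⟩
  n + (4 * C + 2 * K)                        ∎
  where
  open ≤-Reasoning
  expand : ∀ K x y → 2 * K * suc (x + y) ≡ 2 * (K * x + K * y) + 2 * K
  expand = solve-∀
  regroup : ∀ a b C K → 2 * ((a + C) + (b + C)) + 2 * K ≡ 2 * (a + b) + (4 * C + 2 * K)
  regroup = solve-∀

-- Each doubling turns the factor `k + 1` into `2 * (k + 1)`, which is weakened to `k + 2` so that
-- plain induction on `k` applies. `C` grows with `k` but is independent of `n`.
SG-bound : ∀ k → ∃[ C ] (∀ n → suc k * SG n ≤ n + C)
SG-bound zero = 0 , λ n → +-monoˡ-≤ 0 (SG≤n n)
SG-bound (suc k) with SG-bound k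
... | C , bound = 4 * C + 2 * suc k , λ n →
  ≤-trans (*-monoˡ-≤ (SG n) k+2≤2*[k+1]) (SG-bound-double (suc k) C bound n)
  where
  k+2≤2*[k+1] : 2 + k ≤ 2 * suc k
  k+2≤2*[k+1] = +-monoʳ-≤ 1 (≤-trans (s≤s (m≤m+n k 0)) (m≤n+m (suc (k + 0)) k))

SG-sublinear : ∀ q → ∃[ N ] (∀ n → N < n → SG n * q < n)
SG-sublinear q with SG-bound (2 * q)
-- The factor `2 * q + 1` leaves room to absorb `C`: once `n > C`, the bound `n + C` is below
-- `2 * n`, and the 2 cancels.
... | C , bound = C , λ n C<n → *-cancelˡ-< 2 (SG n * q) n (begin-strict
  2 * (SG n * q)         ≡⟨ regroup (SG n) q ⟩
  2 * q * SG n           ≤⟨ *-monoˡ-≤ (SG n) (n≤1+n (2 * q)) ⟩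
  suc (2 * q) * SG n     ≤⟨ bound n ⟩
  n + C                  <⟨ +-monoʳ-< n C<n ⟩
  n + n                  ≡⟨ cong (λ x → n + x) (+-identityʳ n) ⟨
  2 * n                  ∎)
  where
  open ≤-Reasoning
  regroup : ∀ s q → 2 * (s * q) ≡ 2 * q * s
  regroup = solve-∀

fromℚᵘ-mono-< : ∀ {p q} → p ℚᵘ.< q → fromℚᵘ p <ℚ fromℚᵘ q
fromℚᵘ-mono-< {p} {q} p<q = ℚₚ.toℚᵘ-cancel-<
  (ℚᵘₚ.<-respˡ-≃ (ℚᵘₚ.≃-sym (ℚₚ.toℚᵘ-fromℚᵘ p))
    (ℚᵘₚ.<-respʳ-≃ (ℚᵘₚ.≃-sym (ℚₚ.toℚᵘ-fromℚᵘ q)) p<q))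

∣p-0∣≡p : ∀ {p} → 0ℚ ≤ℚ p → ∣ p - 0ℚ ∣ ≡ p
∣p-0∣≡p {p} 0≤p = trans (cong ∣_∣ (ℚₚ.+-identityʳ p)) (ℚₚ.0≤p⇒∣p∣≡p 0≤p)

mainTheorem10 : (λ n → (+ SG n) / n) ConvergesTo 0ℚ
mainTheorem10 (mkℚ (+ zero) _ _) (*<* (ℤ.+<+ ()))
mainTheorem10 (mkℚ (ℤ.-[1+ _ ]) _ _) (*<* ())
-- Here `ε` is `(p + 1) / q` with `q = suc q-1`, hence at least `1 / q`, so `SG n * q < n` is
-- enough. That holds for `N < n`, whence the threshold `suc N`.
mainTheorem10 ε@(mkℚ (+ suc p) q-1 _) _ with SG-sublinear (suc q-1)
... | N , small = suc N , close
  where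
  close : ∀ n .{{_ : ℕ.NonZero n}} → suc N ≤ n → ∣ (+ SG n) / n - 0ℚ ∣ <ℚ ε
  close n@(suc m) N<n = subst (_<ℚ ε)
    (sym (∣p-0∣≡p (ℚₚ.nonNegative⁻¹ _ {{ℚₚ.normalize-nonNeg (SG n) n}})))
    -- Both sides are images under `fromℚᵘ`, so the comparison becomes cross-multiplication of
    -- unreduced fractions, free of gcds.
    (subst ((+ SG n) / n <ℚ_) (ℚₚ.fromℚᵘ-toℚᵘ ε)
      (fromℚᵘ-mono-< {mkℚᵘ (+ SG n) m} {toℚᵘ ε} (ℚᵘ.*<* cross)))
    where
    cross : + SG n ℤ.* + suc q-1 ℤ.< + suc p ℤ.* + n
    cross = subst (ℤ._< + suc p ℤ.* + n) (ℤₚ.pos-* (SG n) (suc q-1))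
      -- `SG n * q < n ≤ n + p * n`, the last being `suc p * n`.
      (ℤ.+<+ (<-≤-trans (small n N<n) (m≤m+n n (p * n))))
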